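{- Setting $s=qx$, $p=x$ and all other parameters ($a,b,c,d,f,g,h,\ell,r,t,u,w$) equal to $1$ in $\mathcal C$, one obtains $$\mathcal C(z)=\sum_{n\ge0}\sum_{\sigma\in\mathcal S_n}x^{\mathsf{des}(\sigma)}q^{\mathsf{occ}_{321}(\sigma)}z^n,$$ where $\mathsf{occ}_{321}(\sigma)$ is the number of occurrences of the consecutive pattern $321$ in $\sigma$ and $\mathsf{des}(\sigma)$ is the number of descents of $\sigma$.
   Context: $\mathcal S_n$ is the set of permutations of $[n]=\{1,\dots,n\}$. A descent of $\sigma\in\mathcal S_n$ is an $i\in[n-1]$ with $\sigma(i)>\sigma(i+1)$. An occurrence of the consecutive pattern $321$ is an index $i$ with $1\le i\le n-2$ and $\sigma(i)>\sigma(i+1)>\sigma(i+2)$. For $n\ge1$, $[n]_{x,y}:=\sum_{i=0}^{n-1}x^{n-1-i}y^{i}$, and $[0]_{x,y}:=0$. For parameters $a,b,c,d,f,g,h,\ell,p,r,s,t,u,w$, $\mathcal C(z)$ is the formal power series in $z$ defined by the continued fraction $$\mathcal C(z)=\cfrac{1}{1-\alpha_0z-\cfrac{\beta_1z^2}{1-\alpha_1z-\cfrac{\beta_2z^2}{\ddots}}},\qquad \alpha_n=u\,w^n+s\,[n]_{a,b}+t\,[n]_{f,g}\ (n\ge 0),\quad \beta_n=p\,r\,[n]_{c,d}\,[n]_{h,\ell}\ (n\ge 1).$$ -}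

module Defs where

open import Algebra.Bundles using (CommutativeRing)
open import Data.Fin.Base as Fin using (Fin; zero; suc; toℕ; inject₁; punchIn)
open import Data.Fin.Patterns using (0F)
open import Data.Fin.Permutation as Perm
  using (Permutation′; _⟨$⟩ʳ_; insert; remove)
open import Data.Fin.Properties as Fin using (punchIn-injective; toℕ<n)
open import Data.List.Base as List
  using (List; []; _∷_; allFin; cartesianProductWith; filter; length)
open import Data.List.Membership.Propositional.Properties using (∈-allFin)
import Data.List.Membership.Setoid as Membership
open import Data.List.Membership.Setoid.Properties
  using (∈-cartesianProductWith⁺; ∈-resp-≈)
open import Data.List.Relation.Unary.All using ([])
open import Data.List.Relation.Unary.Any using (here)
open import Data.List.Relation.Unary.AllPairs using ([]; _∷_)
import Data.List.Relation.Unary.Unique.Setoid as Unique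
open import Data.List.Relation.Unary.Unique.Propositional.Properties
  using (allFin⁺)
open import Data.List.Relation.Unary.Unique.Setoid.Properties
  using (cartesianProductWith⁺)
open import Data.Nat.Base as ℕ using (ℕ; zero; suc; _∸_; s≤s)
import Data.Nat.Properties as ℕ
open import Data.Product.Base using (_×_; _,_)
open import Data.Vec.Base as Vec using (Vec; []; _∷_; head; lookup)
open import Level using (0ℓ)
open import Relation.Binary.Bundles using (Setoid)
open import Relation.Binary.PropositionalEquality as ≡ using (_≡_)
open import Relation.Nullary.Decidable using (_×-dec_)

-- Permutations of Fin n, compared by their values: two inhabitants of
-- the bijection type with the same underlying function need not be
-- propositionally equal.

permutationSetoid : ℕ → Setoid 0ℓ 0ℓ
permutationSetoid n = record
  { Carrier       = Permutation′ n
  ; _≈_           = Perm._≈_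
  ; isEquivalence = record
    { refl  = λ _ → ≡.refl
    ; sym   = λ π≈ρ i → ≡.sym (π≈ρ i)
    ; trans = λ π≈ρ ρ≈τ i → ≡.trans (π≈ρ i) (ρ≈τ i)
    }
  }

-- `insert 0F j π` has first value j, and its remaining values are in the
-- same relative order as those of π.  The two lemmas below show that
-- every permutation is listed exactly once.

permutations : ∀ n → List (Permutation′ n)
permutations zero    = Perm.id ∷ []
permutations (suc n) =
  cartesianProductWith (insert 0F) (allFin (suc n)) (permutations n)

private
  insert-injective : ∀ {n} {j k : Fin (suc n)} {π ρ : Permutation′ n} →
                     insert 0F j π Perm.≈ insert 0F k ρ →
                     j ≡ k × π Perm.≈ ρ
  insert-injective {j = j} eq with eq 0F
  ... | ≡.refl = ≡.refl , λ i → punchIn-injective j _ _ (eq (suc i))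

permutations-complete : ∀ n (π : Permutation′ n) →
                        Membership._∈_ (permutationSetoid n) π (permutations n)
permutations-complete zero    π = here λ ()
permutations-complete (suc n) π =
  ∈-resp-≈ (permutationSetoid (suc n)) {permutations (suc n)}
    {insert 0F (π ⟨$⟩ʳ 0F) (remove 0F π)} {π} (Perm.insert-remove 0F π)
    (∈-cartesianProductWith⁺ (≡.setoid (Fin (suc n))) (permutationSetoid n)
      (permutationSetoid (suc n)) insert-cong
      (∈-allFin (π ⟨$⟩ʳ 0F)) (permutations-complete n (remove 0F π)))
  where
  insert-cong : ∀ {j k : Fin (suc n)} {π ρ : Permutation′ n} → j ≡ k →
                π Perm.≈ ρ → insert 0F j π Perm.≈ insert 0F k ρ
  insert-cong     ≡.refl π≈ρ zero    = ≡.refl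
  insert-cong {j} ≡.refl π≈ρ (suc i) = ≡.cong (punchIn j) (π≈ρ i)

permutations-unique : ∀ n → Unique.Unique (permutationSetoid n) (permutations n)
permutations-unique zero    = [] ∷ []
permutations-unique (suc n) =
  cartesianProductWith⁺ (≡.setoid (Fin (suc n))) (permutationSetoid n)
    (permutationSetoid (suc n)) (insert 0F) insert-injective
    (allFin⁺ (suc n)) (permutations-unique n)

des : ∀ {n} → Permutation′ n → ℕ
des {zero}  σ = 0
des {suc m} σ =
  length (filter (λ i → (σ ⟨$⟩ʳ suc i) Fin.<? (σ ⟨$⟩ʳ inject₁ i)) (allFin m))

occ₃₂₁ : ∀ {n} → Permutation′ n → ℕ
occ₃₂₁ {zero}        σ = 0
occ₃₂₁ {suc zero}    σ = 0
occ₃₂₁ {suc (suc m)} σ = length (filter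
  (λ i → ((σ ⟨$⟩ʳ suc (inject₁ i)) Fin.<? (σ ⟨$⟩ʳ inject₁ (inject₁ i)))
   ×-dec ((σ ⟨$⟩ʳ suc (suc i)) Fin.<? (σ ⟨$⟩ʳ suc (inject₁ i))))
  (allFin m))

module ContinuedFraction {κ μ} (R : CommutativeRing κ μ) where

  open CommutativeRing R
  open import Algebra.Properties.Semiring.Sum semiring
    using (sum-syntax; sum⁺-syntax; sum-cong-≋)
  open import Algebra.Properties.Semiring.Exp semiring public using (_^_)
  open import Relation.Binary.Reasoning.Setoid setoid

  sumOver : ∀ {a} {A : Set a} → List A → (A → Carrier) → Carrier
  sumOver xs f = List.foldr _+_ 0# (List.map f xs)

  -- F n is the coefficient of zⁿ.
  Series : Set κ
  Series = ℕ → Carrier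

  infix  4 _≋_
  infixl 6 _⊖_
  infixl 7 _⊛_ _•_
  infixr 8 z·_

  _≋_ : Series → Series → Set μ
  F ≋ G = ∀ n → F n ≈ G n

  0ₛ 1ₛ : Series
  0ₛ _       = 0#
  1ₛ zero    = 1#
  1ₛ (suc _) = 0#

  _⊖_ : Series → Series → Series
  (F ⊖ G) n = F n - G n

  _⊛_ : Series → Series → Series
  (F ⊛ G) n = ∑[ i ≤ n ] (F (toℕ i) * G (n ∸ toℕ i))

  _•_ : Carrier → Series → Series
  (a • F) n = a * F n

  z·_ : Series → Series
  (z· F) zero    = 0#
  (z· F) (suc n) = F n

  -- The reciprocal of a series with constant term 1 (see ⊛-recip); the
  -- constant term is not inspected.  `recipPrefix F n` holds the first n
  -- coefficients, in decreasing order of degree.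

  private
    recipStep : Series → ∀ n → Vec Carrier n → Carrier
    recipStep F zero    _  = 1#
    recipStep F (suc n) gs = - (∑[ i ≤ n ] (F (suc (toℕ i)) * lookup gs i))

    recipPrefix : Series → ∀ n → Vec Carrier n
    recipPrefix F zero    = []
    recipPrefix F (suc n) = recipStep F n (recipPrefix F n) ∷ recipPrefix F n

    lookup-recipPrefix : ∀ F n (i : Fin (suc n)) →
      lookup (recipPrefix F (suc n)) i ≡ head (recipPrefix F (suc (n ∸ toℕ i)))
    lookup-recipPrefix F n       zero    = ≡.refl
    lookup-recipPrefix F (suc n) (suc i) = lookup-recipPrefix F n i

  recip : Series → Series
  recip F n = head (recipPrefix F (suc n))

  recip-suc : ∀ F n → recip F (suc n) ≈
              - (∑[ i ≤ n ] (F (suc (toℕ i)) * recip F (n ∸ toℕ i)))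
  recip-suc F n = -‿cong (sum-cong-≋ λ i →
    *-congˡ {F (suc (toℕ i))} (reflexive (lookup-recipPrefix F n i)))

  ⊛-recip : ∀ F → F 0 ≈ 1# → F ⊛ recip F ≋ 1ₛ
  ⊛-recip F F₀≈1 zero    = begin
    F 0 * 1# + 0#  ≈⟨ +-identityʳ _ ⟩
    F 0 * 1#       ≈⟨ *-identityʳ _ ⟩
    F 0            ≈⟨ F₀≈1 ⟩
    1#             ∎
  ⊛-recip F F₀≈1 (suc n) = begin
    F 0 * recip F (suc n) + S  ≈⟨ +-congʳ (*-cong F₀≈1 (recip-suc F n)) ⟩
    1# * - S + S               ≈⟨ +-congʳ (*-identityˡ _) ⟩
    - S + S                    ≈⟨ -‿inverseˡ S ⟩
    0#                         ∎
    where
    S = ∑[ i ≤ n ] (F (suc (toℕ i)) * recip F (n ∸ toℕ i))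

  denominator : Carrier → Carrier → Series → Series
  denominator a b T = 1ₛ ⊖ a • z· 1ₛ ⊖ b • z· z· T

  -- `convergent α β m k` consists of m levels of the continued fraction
  -- starting at the denominator containing α k, with what follows
  -- replaced by zero.

  convergent : (α β : ℕ → Carrier) → (m k : ℕ) → Series
  convergent α β zero    k = 0ₛ
  convergent α β (suc m) k =
    recip (denominator (α k) (β (suc k)) (convergent α β m (suc k)))

  -- The limit of the convergents: coefficients of degree below m are the
  -- same in all convergents with at least m levels (see jFraction-limit).

  jFraction : (α β : ℕ → Carrier) → Series
  jFraction α β n = convergent α β (suc n) 0 n

  denominator-const : ∀ a b T → denominator a b T 0 ≈ 1#
  denominator-const a b T = begin
    1# - a * 0# - b * 0#  ≈⟨ +-cong (+-congˡ (-‿cong (zeroʳ a))) (-‿cong (zeroʳ b)) ⟩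
    1# - 0# - 0#          ≈⟨ minus-0 (1# - 0#) ⟩
    1# - 0#               ≈⟨ minus-0 1# ⟩
    1#                    ∎
    where
    minus-0 : ∀ y → y - 0# ≈ y
    minus-0 y = begin
      y - 0#          ≈⟨ +-identityʳ _ ⟨
      y - 0# + 0#     ≈⟨ +-assoc _ _ _ ⟩
      y + (- 0# + 0#) ≈⟨ +-congˡ (-‿inverseˡ 0#) ⟩
      y + 0#          ≈⟨ +-identityʳ y ⟩
      y               ∎

  private
    AgreeBelow : ℕ → Series → Series → Set μ
    AgreeBelow n F G = ∀ j → j ℕ.< n → F j ≈ G j

    recip-agree : ∀ {F G n} → AgreeBelow n F G → AgreeBelow n (recip F) (recip G)
    recip-agree {F} {G} {n} F≈G j j<n = go j j ℕ.≤-refl j<n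
      where
      go : ∀ m j → j ℕ.≤ m → j ℕ.< n → recip F j ≈ recip G j
      go m       zero    _         _   = refl
      go (suc m) (suc j) (s≤s j≤m) j<n = begin
        recip F (suc j)
          ≈⟨ recip-suc F j ⟩
        - (∑[ i ≤ j ] (F (suc (toℕ i)) * recip F (j ∸ toℕ i)))
          ≈⟨ -‿cong (sum-cong-≋ λ i → *-cong
               (F≈G _ (ℕ.≤-<-trans (toℕ<n i) j<n))
               (go m _ (ℕ.≤-trans (ℕ.m∸n≤m j (toℕ i)) j≤m)
                  (ℕ.≤-<-trans (ℕ.m∸n≤m j (toℕ i)) (ℕ.<-trans (ℕ.n<1+n j) j<n)))) ⟩
        - (∑[ i ≤ j ] (G (suc (toℕ i)) * recip G (j ∸ toℕ i)))
          ≈⟨ recip-suc G j ⟨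
        recip G (suc j) ∎

    denominator-agree : ∀ a b {S T n} → AgreeBelow n S T →
      AgreeBelow (suc n) (denominator a b S) (denominator a b T)
    denominator-agree a b S≈T zero          _         = refl
    denominator-agree a b S≈T (suc zero)    _         = refl
    denominator-agree a b S≈T (suc (suc j)) (s≤s j<n) =
      +-congˡ (-‿cong (*-congˡ (S≈T j (ℕ.<-trans (ℕ.n<1+n j) j<n))))

  convergent-stable : ∀ α β {n m m′} → n ℕ.≤ m → n ℕ.≤ m′ → ∀ k j → j ℕ.< n →
                      convergent α β m k j ≈ convergent α β m′ k j
  convergent-stable α β (s≤s n≤m) (s≤s n≤m′) k =
    recip-agree (denominator-agree (α k) (β (suc k))
      (convergent-stable α β n≤m n≤m′ (suc k)))

  jFraction-limit : ∀ α β {m n} → n ℕ.< m →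
                    convergent α β m 0 n ≈ jFraction α β n
  jFraction-limit α β {n = n} n<m =
    convergent-stable α β n<m ℕ.≤-refl 0 n (ℕ.n<1+n n)

  [_]⟨_,_⟩ : ℕ → Carrier → Carrier → Carrier
  [ n ]⟨ x , y ⟩ = ∑[ i < n ] (x ^ (n ∸ 1 ∸ toℕ i) * y ^ toℕ i)

  record Parameters : Set κ where
    field
      a b c d f g h ℓ p r s t u w : Carrier

  module _ (P : Parameters) where
    open Parameters P

    α β : ℕ → Carrier
    α n = u * w ^ n + s * [ n ]⟨ a , b ⟩ + t * [ n ]⟨ f , g ⟩
    β n = p * r * [ n ]⟨ c , d ⟩ * [ n ]⟨ h , ℓ ⟩

    𝒞 : Series
    𝒞 = jFraction α β

  specialisation : (x q : Carrier) → Parameters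
  specialisation x q = record
    { s = q * x
    ; p = x
    ; a = 1# ; b = 1# ; c = 1# ; d = 1# ; f = 1# ; g = 1# ; h = 1# ; ℓ = 1#
    ; r = 1# ; t = 1# ; u = 1# ; w = 1#
    }

{-# OPTIONS --safe #-}

-- Let U be the exponential generating function of the weights x^des q^occ,
-- and refine U by the first value.  Deleting the first letter shows that the
-- refined sums are the coefficients of U(s + t) a(s) and, when a descent
-- precedes the permutation, of U(s + t) b(s), where a′ = x b − a,
-- b′ = q x b − a and a(0) = b(0) = 1.  Summing over the first value gives
-- U = 1 + U A with A′ = a and A(0) = 0.  Hence P = U a − 1 satisfies the
-- Riccati equation P′ = x + (1 + q x) P + P², and U′ = (1 + P) U, so that
--   (Pʰ U)′ = h x Pʰ⁻¹ U + (1 + h (1 + q x)) Pʰ U + (h + 1) Pʰ⁺¹ U.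
-- This is the recurrence of weighted Motzkin paths from height h to 0, whose
-- weights are those of the continued fraction.
-- Exponential generating functions are represented by their coefficient
-- sequences (aₙ for Σ aₙ zⁿ/n!), so no division is needed.

module Submission where

open import Algebra.Bundles using (CommutativeRing; CommutativeSemiring)
open import Algebra.Structures.Biased
  using (isCommutativeMonoidˡ; isCommutativeSemiringˡ)
open import Data.Bool.Base using (Bool; true; false; if_then_else_; _∧_)
open import Data.Fin.Base
  using (Fin; zero; suc; toℕ; inject₁; fromℕ; punchIn)
open import Data.Fin.Induction using (<-weakInduction)
open import Data.Fin.Patterns using (0F; 1F)
open import Data.Fin.Permutation using (Permutation′; _⟨$⟩ʳ_; insert)
open import Data.Fin.Properties
  using (toℕ-inject₁; toℕ-fromℕ; toℕ<n; toℕ≤pred[n])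
open import Data.List.Base as List
  using (List; []; _∷_; tabulate; cartesianProductWith; filter; length)
open import Data.Nat.Base as ℕ using (ℕ; zero; suc; _∸_; _<ᵇ_; s≤s)
import Data.Nat.Properties as ℕ
open import Defs
open import Function.Base using (_∘_; id)
open import Relation.Binary.PropositionalEquality as ≡ using (_≡_)
open import Relation.Binary.Structures using (IsEquivalence)
open import Relation.Nullary.Decidable using (does)
open import Relation.Unary using (Pred; Decidable)

-- The commutative semiring of exponential generating functions.

module Hurwitz {κ μ} (S : CommutativeSemiring κ μ) where

  open CommutativeSemiring S
  open import Algebra.Solver.Ring.NaturalCoefficients.Default S
    using (solve; _:=_; _:+_; _:*_)
  open import Relation.Binary.Reasoning.Setoid setoid

  infix  4 _≋_
  infixl 6 _⊞_
  infixl 7 _⋆_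

  Sequence : Set κ
  Sequence = ℕ → Carrier

  _≋_ : Sequence → Sequence → Set μ
  F ≋ G = ∀ n → F n ≈ G n

  _⊞_ : Sequence → Sequence → Sequence
  (F ⊞ G) n = F n + G n

  const : Carrier → Sequence
  const c zero    = c
  const c (suc _) = 0#

  ∂ : Sequence → Sequence
  ∂ F n = F (suc n)

  -- The product of exponential generating functions, defined by the Leibniz
  -- rule instead of binomial coefficients.
  _⋆_ : Sequence → Sequence → Sequence
  (F ⋆ G) zero    = F 0 * G 0
  (F ⋆ G) (suc n) = (∂ F ⋆ G) n + (F ⋆ ∂ G) n

  ⋆-cong : ∀ {F F′ G G′} → F ≋ F′ → G ≋ G′ → F ⋆ G ≋ F′ ⋆ G′
  ⋆-cong F≋F′ G≋G′ zero    = *-cong (F≋F′ 0) (G≋G′ 0)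
  ⋆-cong F≋F′ G≋G′ (suc n) = +-cong
    (⋆-cong (λ i → F≋F′ (suc i)) G≋G′ n) (⋆-cong F≋F′ (λ i → G≋G′ (suc i)) n)

  ⋆-comm : ∀ F G → F ⋆ G ≋ G ⋆ F
  ⋆-comm F G zero    = *-comm _ _
  ⋆-comm F G (suc n) = trans (+-cong (⋆-comm (∂ F) G n) (⋆-comm F (∂ G) n)) (+-comm _ _)

  ⋆-distribʳ : ∀ H F G → (F ⊞ G) ⋆ H ≋ F ⋆ H ⊞ G ⋆ H
  ⋆-distribʳ H F G zero    = distribʳ _ _ _
  ⋆-distribʳ H F G (suc n) = begin
    ((∂ F ⊞ ∂ G) ⋆ H) n + ((F ⊞ G) ⋆ ∂ H) n
      ≈⟨ +-cong (⋆-distribʳ H (∂ F) (∂ G) n) (⋆-distribʳ (∂ H) F G n) ⟩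
    ((∂ F ⋆ H) n + (∂ G ⋆ H) n) + ((F ⋆ ∂ H) n + (G ⋆ ∂ H) n)
      ≈⟨ interchange _ _ _ _ ⟩
    ((∂ F ⋆ H) n + (F ⋆ ∂ H) n) + ((∂ G ⋆ H) n + (G ⋆ ∂ H) n) ∎
    where
    interchange : ∀ a b c d → (a + b) + (c + d) ≈ (a + c) + (b + d)
    interchange = solve 4 (λ a b c d → (a :+ b) :+ (c :+ d) := (a :+ c) :+ (b :+ d)) refl

  ⋆-distribˡ : ∀ H F G → H ⋆ (F ⊞ G) ≋ H ⋆ F ⊞ H ⋆ G
  ⋆-distribˡ H F G n = begin
    (H ⋆ (F ⊞ G)) n        ≈⟨ ⋆-comm H (F ⊞ G) n ⟩
    ((F ⊞ G) ⋆ H) n        ≈⟨ ⋆-distribʳ H F G n ⟩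
    (F ⋆ H) n + (G ⋆ H) n  ≈⟨ +-cong (⋆-comm F H n) (⋆-comm G H n) ⟩
    (H ⋆ F) n + (H ⋆ G) n  ∎

  -- By the Leibniz rule both derivatives expand into the same three products, each with one factor
  -- differentiated.
  ⋆-assoc : ∀ F G H → (F ⋆ G) ⋆ H ≋ F ⋆ (G ⋆ H)
  ⋆-assoc F G H zero    = *-assoc _ _ _
  ⋆-assoc F G H (suc n) = begin
    ((∂ F ⋆ G ⊞ F ⋆ ∂ G) ⋆ H) n + (F ⋆ G ⋆ ∂ H) n
      ≈⟨ +-congʳ (⋆-distribʳ H (∂ F ⋆ G) (F ⋆ ∂ G) n) ⟩
    (∂ F ⋆ G ⋆ H) n + (F ⋆ ∂ G ⋆ H) n + (F ⋆ G ⋆ ∂ H) n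
      ≈⟨ +-cong (+-cong (⋆-assoc (∂ F) G H n) (⋆-assoc F (∂ G) H n)) (⋆-assoc F G (∂ H) n) ⟩
    (∂ F ⋆ (G ⋆ H)) n + (F ⋆ (∂ G ⋆ H)) n + (F ⋆ (G ⋆ ∂ H)) n
      ≈⟨ +-assoc _ _ _ ⟩
    (∂ F ⋆ (G ⋆ H)) n + ((F ⋆ (∂ G ⋆ H)) n + (F ⋆ (G ⋆ ∂ H)) n)
      ≈⟨ +-congˡ (⋆-distribˡ F (∂ G ⋆ H) (G ⋆ ∂ H) n) ⟨
    (∂ F ⋆ (G ⋆ H)) n + (F ⋆ (∂ G ⋆ H ⊞ G ⋆ ∂ H)) n ∎

  ⋆-zeroˡ : ∀ F n → ((λ _ → 0#) ⋆ F) n ≈ 0#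
  ⋆-zeroˡ F zero    = zeroˡ _
  ⋆-zeroˡ F (suc n) = trans (+-cong (⋆-zeroˡ F n) (⋆-zeroˡ (∂ F) n)) (+-identityˡ _)

  const-⋆ : ∀ c F n → (const c ⋆ F) n ≈ c * F n
  const-⋆ c F zero    = refl
  const-⋆ c F (suc n) = trans (+-cong (⋆-zeroˡ F n) (const-⋆ c (∂ F) n)) (+-identityˡ _)

  -- Allows the abstract derivation in `Riccati`, with its ring solver, to be applied to sequences.
  commutativeSemiring : CommutativeSemiring κ μ
  commutativeSemiring = record
    { Carrier = Sequence
    ; _≈_     = _≋_
    ; _+_     = _⊞_
    ; _*_     = _⋆_
    ; 0#      = λ _ → 0#
    ; 1#      = const 1#
    ; isCommutativeSemiring = isCommutativeSemiringˡ record
      { +-isCommutativeMonoid = isCommutativeMonoidˡ record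
        { isSemigroup = record
          { isMagma = record
            { isEquivalence = ≋-isEquivalence
            ; ∙-cong        = λ p r n → +-cong (p n) (r n)
            }
          ; assoc   = λ F G H n → +-assoc _ _ _
          }
        ; identityˡ   = λ F n → +-identityˡ _
        ; comm        = λ F G n → +-comm _ _
        }
      ; *-isCommutativeMonoid = isCommutativeMonoidˡ record
        { isSemigroup = record
          { isMagma = record { isEquivalence = ≋-isEquivalence ; ∙-cong = ⋆-cong }
          ; assoc   = ⋆-assoc
          }
        ; identityˡ   = λ F n → trans (const-⋆ 1# F n) (*-identityˡ _)
        ; comm        = ⋆-comm
        }
      ; distribʳ              = ⋆-distribʳ
      ; zeroˡ                 = ⋆-zeroˡ
      }
    }
    where
    ≋-isEquivalence : IsEquivalence _≋_
    ≋-isEquivalence = record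
      { refl  = λ _ → refl
      ; sym   = λ p n → sym (p n)
      ; trans = λ p r n → trans (p n) (r n)
      }

-- Power series and continued fractions.

module JFraction {κ μ} (R : CommutativeRing κ μ) where

  open CommutativeRing R hiding (zero)
  open ContinuedFraction R
  open import Algebra.Properties.Group +-group using (inverseʳ-unique)
  open import Algebra.Properties.AbelianGroup +-abelianGroup using (⁻¹-∙-comm)
  open import Algebra.Properties.CommutativeSemigroup *-commutativeSemigroup using (x∙yz≈y∙xz)
  open import Algebra.Properties.Semiring.Sum semiring
    using (sum-cong-≋; ∑-distrib-+; *-distribˡ-sum)
  open import Algebra.Solver.Ring.NaturalCoefficients.Default commutativeSemiring
    using (solve; _:=_; _:+_; _:*_; con)
  open import Relation.Binary.Reasoning.Setoid setoid

  private
    tail : Series → Series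
    tail F n = F (suc n)

  infixl 6 _⊕_
  _⊕_ : Series → Series → Series
  (F ⊕ G) n = F n + G n

  -- A bounded congruence, since a finite convergent agrees with its limit only in low degrees.
  ⊛-cong≤ : ∀ {F F′ G G′} n → (∀ i → i ℕ.≤ n → F i ≈ F′ i) →
            (∀ i → i ℕ.≤ n → G i ≈ G′ i) → (F ⊛ G) n ≈ (F′ ⊛ G′) n
  ⊛-cong≤ n F≈F′ G≈G′ = sum-cong-≋ λ i →
    *-cong (F≈F′ (toℕ i) (ℕ.s≤s⁻¹ (toℕ<n i))) (G≈G′ (n ∸ toℕ i) (ℕ.m∸n≤m n (toℕ i)))

  ⊛-cong : ∀ {F F′ G G′} → F ≋ F′ → G ≋ G′ → F ⊛ G ≋ F′ ⊛ G′
  ⊛-cong F≋F′ G≋G′ n = ⊛-cong≤ n (λ i _ → F≋F′ i) (λ i _ → G≋G′ i)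

  ⊛-distribʳ : ∀ H F G → (F ⊕ G) ⊛ H ≋ F ⊛ H ⊕ G ⊛ H
  ⊛-distribʳ H F G n = trans
    (sum-cong-≋ {suc n} λ i → distribʳ (H (n ∸ toℕ i)) (F (toℕ i)) (G (toℕ i)))
    (∑-distrib-+ {suc n} (λ i → F (toℕ i) * H (n ∸ toℕ i)) (λ i → G (toℕ i) * H (n ∸ toℕ i)))

  •-⊛ : ∀ c F G → (c • F) ⊛ G ≋ c • (F ⊛ G)
  •-⊛ c F G n = trans (sum-cong-≋ {suc n} λ i → *-assoc c (F (toℕ i)) (G (n ∸ toℕ i)))
    (sym (*-distribˡ-sum {suc n} c (λ i → F (toℕ i) * G (n ∸ toℕ i))))

  ⊛-• : ∀ c F G → F ⊛ (c • G) ≋ c • (F ⊛ G)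
  ⊛-• c F G n = trans (sum-cong-≋ {suc n} λ i → x∙yz≈y∙xz (F (toℕ i)) c (G (n ∸ toℕ i)))
    (sym (*-distribˡ-sum {suc n} c (λ i → F (toℕ i) * G (n ∸ toℕ i))))

  -- Induction on the degree, splitting off the constant term of `F`: the tail of `F ⊛ G` unfolds to
  -- `F 0 • tail G ⊕ tail F ⊛ G`.
  ⊛-assoc : ∀ F G H → (F ⊛ G) ⊛ H ≋ F ⊛ (G ⊛ H)
  ⊛-assoc F G H zero    =
    solve 3 (λ f g h → (f :* g :+ con 0) :* h :+ con 0 := f :* (g :* h :+ con 0) :+ con 0)
      refl (F 0) (G 0) (H 0)
  ⊛-assoc F G H (suc n) = begin
    (F 0 * G 0 + 0#) * H (suc n) + ((F 0 • tail G ⊕ tail F ⊛ G) ⊛ H) n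
      ≈⟨ +-congˡ (⊛-distribʳ H (F 0 • tail G) (tail F ⊛ G) n) ⟩
    (F 0 * G 0 + 0#) * H (suc n) + (((F 0 • tail G) ⊛ H) n + (tail F ⊛ G ⊛ H) n)
      ≈⟨ +-congˡ (+-cong (•-⊛ (F 0) (tail G) H n) (⊛-assoc (tail F) G H n)) ⟩
    (F 0 * G 0 + 0#) * H (suc n) + (F 0 * (tail G ⊛ H) n + (tail F ⊛ (G ⊛ H)) n)
      ≈⟨ solve 5 (λ f g h s t → (f :* g :+ con 0) :* h :+ (f :* s :+ t) := f :* (g :* h :+ s) :+ t)
           refl (F 0) (G 0) (H (suc n)) ((tail G ⊛ H) n) ((tail F ⊛ (G ⊛ H)) n) ⟩
    F 0 * (G ⊛ H) (suc n) + (tail F ⊛ (G ⊛ H)) n ∎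

  ⊛-zeroˡ : ∀ F → 0ₛ ⊛ F ≋ 0ₛ
  ⊛-zeroˡ F zero    = trans (+-identityʳ _) (zeroˡ _)
  ⊛-zeroˡ F (suc n) = trans (+-cong (zeroˡ _) (⊛-zeroˡ F n)) (+-identityˡ _)

  ⊛-identityˡ : ∀ F → 1ₛ ⊛ F ≋ F
  ⊛-identityˡ F zero    = trans (+-identityʳ _) (*-identityˡ _)
  ⊛-identityˡ F (suc n) = trans (+-cong (*-identityˡ _) (⊛-zeroˡ F n)) (+-identityʳ _)

  z·-⊛ : ∀ F G → (z· F) ⊛ G ≋ z· (F ⊛ G)
  z·-⊛ F G zero    = trans (+-identityʳ _) (zeroˡ _)
  z·-⊛ F G (suc n) = trans (+-congʳ (zeroˡ _)) (+-identityˡ _)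

  ⊛-z· : ∀ F G → F ⊛ (z· G) ≋ z· (F ⊛ G)
  ⊛-z· F G zero          = trans (+-identityʳ _) (zeroʳ _)
  ⊛-z· F G (suc zero)    = +-congˡ (⊛-z· (tail F) G zero)
  ⊛-z· F G (suc (suc n)) = +-congˡ (⊛-z· (tail F) G (suc n))

  -- Reads off degree n + 1 in G (1 - a z - b z² T) = 1. The tail of the denominator is the negative
  -- of E = a + b z T, so the sign in `recip-suc` disappears.
  recip-denominator-suc : ∀ a b T n → let G = recip (denominator a b T) in
                          G (suc n) ≈ a * G n + b * (z· T ⊛ G) n
  recip-denominator-suc a b T n = begin
    G (suc n)                              ≈⟨ recip-suc D n ⟩
    - (tail D ⊛ G) n                       ≈⟨ inverseʳ-unique _ _ opposite ⟨
    (E ⊛ G) n                              ≈⟨ ⊛-distribʳ G (a • 1ₛ) (b • z· T) n ⟩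
    ((a • 1ₛ) ⊛ G) n + ((b • z· T) ⊛ G) n  ≈⟨ +-cong (•-⊛ a 1ₛ G n) (•-⊛ b (z· T) G n) ⟩
    a * (1ₛ ⊛ G) n + b * (z· T ⊛ G) n      ≈⟨ +-congʳ (*-congˡ (⊛-identityˡ G n)) ⟩
    a * G n + b * (z· T ⊛ G) n             ∎
    where
    D G E : Series
    D = denominator a b T
    G = recip D
    E = a • 1ₛ ⊕ b • z· T

    tail-D : ∀ i → tail D i ≈ - E i
    tail-D i = trans (+-congʳ (+-identityˡ _)) (⁻¹-∙-comm _ _)

    opposite : (tail D ⊛ G) n + (E ⊛ G) n ≈ 0#
    opposite = begin
      (tail D ⊛ G) n + (E ⊛ G) n  ≈⟨ ⊛-distribʳ G (tail D) E n ⟨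
      ((tail D ⊕ E) ⊛ G) n
        ≈⟨ ⊛-cong {G = G} (λ i → trans (+-congʳ (tail-D i)) (-‿inverseˡ (E i))) (λ _ → refl) n ⟩
      (0ₛ ⊛ G) n                  ≈⟨ ⊛-zeroˡ G n ⟩
      0#                          ∎

  -- Weighted Motzkin paths of a continued fraction.

  module _ (α β up down : ℕ → Carrier)
           (β≈up*down : ∀ h → β (suc h) ≈ up h * down h) where

    -- The limit of the convergents starting at the denominator containing α h.
    K : ℕ → Series
    K h n = convergent α β (suc n) h n

    convergent≈K : ∀ h {i n} → i ℕ.< n → convergent α β n h i ≈ K h i
    convergent≈K h {i} i<n = convergent-stable α β i<n ℕ.≤-refl h i (ℕ.n<1+n i)

    K-suc : ∀ h n → K h (suc n) ≈ α h * K h n + β (suc h) * (z· (K (suc h) ⊛ K h)) n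
    K-suc h n = begin
      K h (suc n)
        ≈⟨ recip-denominator-suc (α h) (β (suc h)) T n ⟩
      α h * G n + β (suc h) * (z· T ⊛ G) n
        -- The n + 2 levels of `G` determine it up to degree n + 1, and the n + 1 levels of `T`
        -- determine it up to degree n, which covers every coefficient that occurs.
        ≈⟨ +-cong (*-congˡ (convergent≈K h (s≤s (ℕ.n≤1+n n))))
             (*-congˡ (⊛-cong≤ n z·T≈ λ i i≤n → convergent≈K h (s≤s (ℕ.m≤n⇒m≤1+n i≤n)))) ⟩
      α h * K h n + β (suc h) * (z· K (suc h) ⊛ K h) n
        ≈⟨ +-congˡ (*-congˡ (z·-⊛ (K (suc h)) (K h) n)) ⟩
      α h * K h n + β (suc h) * (z· (K (suc h) ⊛ K h)) n ∎
      where
      T G : Series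
      T = convergent α β (suc n) (suc h)
      G = convergent α β (suc (suc n)) h

      z·T≈ : ∀ i → i ℕ.≤ n → (z· T) i ≈ (z· K (suc h)) i
      z·T≈ zero    _   = refl
      z·T≈ (suc i) i≤n = convergent≈K (suc h) (ℕ.m≤n⇒m≤1+n i≤n)

    -- First-passage decomposition of paths from height h to 0: an excursion that stays at or above
    -- height h + 1, the first step down to h, then a path from h.
    pathsFrom : ℕ → Series
    pathsFrom zero    = K 0
    pathsFrom (suc h) = down h • z· (K (suc h) ⊛ pathsFrom h)

    pathsFrom-zero : ∀ n → pathsFrom 0 (suc n) ≈ α 0 * pathsFrom 0 n + up 0 * pathsFrom 1 n
    pathsFrom-zero n = trans (K-suc 0 n)
      (+-congˡ (trans (*-congʳ (β≈up*down 0)) (*-assoc _ _ _)))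

    -- If the leading excursion is empty, the first step goes down. Otherwise `K-suc` exposes its
    -- first step, level or up; after an up step, reassociating the remaining pieces gives a path
    -- from height h + 2.
    pathsFrom-suc : ∀ h n → pathsFrom (suc h) (suc n) ≈
      down h * pathsFrom h n + α (suc h) * pathsFrom (suc h) n
        + up (suc h) * pathsFrom (suc (suc h)) n
    pathsFrom-suc h zero    =
      solve 5 (λ d p a u d′ → d :* (con 1 :* p :+ con 0) :=
                 d :* p :+ a :* (d :* con 0) :+ u :* (d′ :* con 0))
        refl (down h) (pathsFrom h 0) (α (suc h)) (up (suc h)) (down (suc h))
    pathsFrom-suc h (suc n) = begin
      d * (1# * P (suc n) + (tail K₁ ⊛ P) n)
        ≈⟨ *-congˡ (+-congˡ (⊛-cong {G = P} (K-suc (suc h)) (λ _ → refl) n)) ⟩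
      d * (1# * P (suc n) + ((a • K₁ ⊕ β (suc (suc h)) • z· (K₂ ⊛ K₁)) ⊛ P) n)
        ≈⟨ *-congˡ (+-congˡ (⊛-distribʳ P (a • K₁) (β (suc (suc h)) • z· (K₂ ⊛ K₁)) n)) ⟩
      d * (1# * P (suc n) + (((a • K₁) ⊛ P) n + ((β (suc (suc h)) • z· (K₂ ⊛ K₁)) ⊛ P) n))
        ≈⟨ *-congˡ (+-congˡ (+-cong (•-⊛ a K₁ P n) (•-⊛ (β (suc (suc h))) (z· (K₂ ⊛ K₁)) P n))) ⟩
      d * (1# * P (suc n) + (a * (K₁ ⊛ P) n + β (suc (suc h)) * (z· (K₂ ⊛ K₁) ⊛ P) n))
        ≈⟨ *-congˡ (+-congˡ (+-congˡ (*-cong (β≈up*down (suc h)) shifted))) ⟩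
      d * (1# * P (suc n) + (a * (K₁ ⊛ P) n + u * down (suc h) * (K₂ ⊛ z· (K₁ ⊛ P)) n))
        ≈⟨ solve 7 (λ d p a y u d′ w → d :* (con 1 :* p :+ (a :* y :+ u :* d′ :* w)) :=
                      d :* p :+ a :* (d :* y) :+ u :* (d′ :* (d :* w)))
             refl d (P (suc n)) a ((K₁ ⊛ P) n) u (down (suc h)) ((K₂ ⊛ z· (K₁ ⊛ P)) n) ⟩
      d * P (suc n) + a * (d * (K₁ ⊛ P) n) + u * (down (suc h) * (d * (K₂ ⊛ z· (K₁ ⊛ P)) n))
        ≈⟨ +-congˡ (*-congˡ (*-congˡ (⊛-• d K₂ (z· (K₁ ⊛ P)) n))) ⟨
      d * P (suc n) + a * (d * (K₁ ⊛ P) n) + u * (down (suc h) * (K₂ ⊛ pathsFrom (suc h)) n) ∎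
      where
      d a u : Carrier
      d = down h
      a = α (suc h)
      u = up (suc h)
      P K₁ K₂ : Series
      P  = pathsFrom h
      K₁ = K (suc h)
      K₂ = K (suc (suc h))

      shifted : (z· (K₂ ⊛ K₁) ⊛ P) n ≈ (K₂ ⊛ z· (K₁ ⊛ P)) n
      shifted = begin
        (z· (K₂ ⊛ K₁) ⊛ P) n    ≈⟨ z·-⊛ (K₂ ⊛ K₁) P n ⟩
        (z· (K₂ ⊛ K₁ ⊛ P)) n    ≈⟨ z·-cong (⊛-assoc K₂ K₁ P) n ⟩
        (z· (K₂ ⊛ (K₁ ⊛ P))) n  ≈⟨ ⊛-z· K₂ (K₁ ⊛ P) n ⟨
        (K₂ ⊛ z· (K₁ ⊛ P)) n    ∎
        where
        z·-cong : ∀ {F G} → F ≋ G → z· F ≋ z· G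
        z·-cong F≋G zero    = refl
        z·-cong F≋G (suc n) = F≋G n

    -- The hypotheses say that F h n is the weighted count of Motzkin paths of
    -- length n from height h to 0.
    jFraction-unique : (F : ℕ → Series) → F 0 0 ≈ 1# → (∀ h → F (suc h) 0 ≈ 0#) →
      (∀ n → F 0 (suc n) ≈ α 0 * F 0 n + up 0 * F 1 n) →
      (∀ h n → F (suc h) (suc n) ≈
        down h * F h n + α (suc h) * F (suc h) n + up (suc h) * F (suc (suc h)) n) →
      jFraction α β ≋ F 0
    jFraction-unique F F₀₀ F₊₀ F₀₊ F₊₊ n = sym (F≈pathsFrom n 0)
      where
      -- The induction on length keeps the height arbitrary, because the first step may change it.
      F≈pathsFrom : ∀ n h → F h n ≈ pathsFrom h n
      F≈pathsFrom zero    zero    = F₀₀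
      F≈pathsFrom zero    (suc h) = trans (F₊₀ h) (sym (zeroʳ _))
      F≈pathsFrom (suc n) zero    = trans (F₀₊ n)
        (trans (+-cong (*-congˡ (F≈pathsFrom n 0)) (*-congˡ (F≈pathsFrom n 1)))
          (sym (pathsFrom-zero n)))
      F≈pathsFrom (suc n) (suc h) = trans (F₊₊ h n)
        (trans (+-cong (+-cong (*-congˡ (F≈pathsFrom n h)) (*-congˡ (F≈pathsFrom n (suc h))))
                       (*-congˡ (F≈pathsFrom n (suc (suc h)))))
               (sym (pathsFrom-suc h n)))

-- The Riccati equation and the derivatives of Pʰ U.

module Riccati {κ μ} (S : CommutativeSemiring κ μ) where

  open CommutativeSemiring S hiding (zero)
  open import Algebra.Definitions _≈_ using (RightCancellative)
  open import Algebra.Solver.Ring.NaturalCoefficients.Default S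
    using (solve; _:=_; _:+_; _:*_; con)
  open import Relation.Binary.Reasoning.Setoid setoid

  -- Cancellation takes the place of subtraction, so every identity can be checked by the semiring
  -- solver. `∂U-fixed` and `∂P` are the differentiated forms of `U-fixed` and `Ua≈1+P`, with `a` as
  -- the derivative of `A`, and `ν h` stands for the number h.
  module Solution
    (+-cancelʳ : RightCancellative _+_)
    (∂ : Carrier → Carrier)
    (leibniz : ∀ f g → ∂ (f * g) ≈ ∂ f * g + f * ∂ g)
    {x q A a b U P : Carrier}
    (∂a : ∂ a + a ≈ x * b)
    (b-integral : b + (q + A) ≈ q * a + 1# + q * A)
    (U-fixed : U ≈ 1# + U * A)
    (∂U-fixed : ∂ U ≈ ∂ U * A + U * a)
    (Ua≈1+P : U * a ≈ 1# + P) (∂P : ∂ P ≈ ∂ (U * a))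
    (ν : ℕ → Carrier) (ν-zero : ν 0 ≈ 0#) (ν-suc : ∀ h → ν (suc h) ≈ 1# + ν h)
    where

    -- Since ∂U (1 - A) = U a and U (1 - A) = 1, multiplying the former by U gives ∂U = U a U = (1 +
    -- P) U.
    ∂U : ∂ U ≈ U + P * U
    ∂U = trans (+-cancelʳ _ _ _ (begin
      ∂ U + U * A * ∂ U         ≈⟨ +-congʳ (*-identityˡ _) ⟨
      1# * ∂ U + U * A * ∂ U    ≈⟨ distribʳ _ _ _ ⟨
      (1# + U * A) * ∂ U        ≈⟨ *-congʳ U-fixed ⟨
      U * ∂ U                   ≈⟨ *-congˡ ∂U-fixed ⟩
      U * (∂ U * A + U * a)
        ≈⟨ solve 4 (λ u v A w → u :* (v :* A :+ w) := w :* u :+ u :* A :* v)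
             refl U (∂ U) A (U * a) ⟩
      U * a * U + U * A * ∂ U   ∎))
      (begin
      U * a * U      ≈⟨ *-congʳ Ua≈1+P ⟩
      (1# + P) * U   ≈⟨ distribʳ _ _ _ ⟩
      1# * U + P * U ≈⟨ +-congʳ (*-identityˡ _) ⟩
      U + P * U      ∎)

    -- Multiplying b - q a = (1 - q)(1 - A) by U gives U b - q (1 + P) = 1 - q.
    Ub≈1+qP : U * b ≈ 1# + q * P
    Ub≈1+qP = +-cancelʳ _ _ _ (begin
      U * b + (q + (q * (U * A) + U * A))
        ≈⟨ solve 3 (λ b′ q w → b′ :+ (q :+ (q :* w :+ w)) := b′ :+ (q :* (con 1 :+ w) :+ w))
             refl (U * b) q (U * A) ⟩
      U * b + (q * (1# + U * A) + U * A)
        ≈⟨ +-congˡ (+-congʳ (*-congˡ U-fixed)) ⟨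
      U * b + (q * U + U * A)
        ≈⟨ solve 4 (λ u b q A → u :* b :+ (q :* u :+ u :* A) := u :* (b :+ (q :+ A))) refl U b q A ⟩
      U * (b + (q + A))
        ≈⟨ *-congˡ b-integral ⟩
      U * (q * a + 1# + q * A)
        ≈⟨ solve 4 (λ u a q A → u :* (q :* a :+ con 1 :+ q :* A) :=
             q :* (u :* a) :+ u :+ q :* (u :* A))
             refl U a q A ⟩
      q * (U * a) + U + q * (U * A)
        ≈⟨ +-congʳ (+-cong (*-congˡ Ua≈1+P) U-fixed) ⟩
      q * (1# + P) + (1# + U * A) + q * (U * A)
        ≈⟨ solve 3 (λ q p w → q :* (con 1 :+ p) :+ (con 1 :+ w) :+ q :* w :=
             con 1 :+ q :* p :+ (q :+ (q :* w :+ w))) refl q P (U * A) ⟩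
      1# + q * P + (q + (q * (U * A) + U * A)) ∎)

    -- Differentiating U a gives (1 + P) U a + U (x b - a). Adding U a to both sides removes the
    -- minus sign, and `Ua≈1+P` and `Ub≈1+qP` eliminate the remaining products.
    riccati : ∂ P ≈ x + (P + q * (x * P)) + P * P
    riccati = +-cancelʳ (U * a) _ _ (begin
      ∂ P + U * a                       ≈⟨ +-congʳ (trans ∂P (leibniz U a)) ⟩
      ∂ U * a + U * ∂ a + U * a
        ≈⟨ solve 4 (λ v a u a′ → v :* a :+ u :* a′ :+ u :* a := v :* a :+ u :* (a′ :+ a))
             refl (∂ U) a U (∂ a) ⟩
      ∂ U * a + U * (∂ a + a)           ≈⟨ +-cong (*-congʳ ∂U) (*-congˡ ∂a) ⟩
      (U + P * U) * a + U * (x * b)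
        ≈⟨ solve 5 (λ u p a x b → (u :+ p :* u) :* a :+ u :* (x :* b) :=
             u :* a :+ p :* (u :* a) :+ x :* (u :* b))
             refl U P a x b ⟩
      U * a + P * (U * a) + x * (U * b)
        ≈⟨ +-cong (+-congˡ (*-congˡ Ua≈1+P)) (*-congˡ Ub≈1+qP) ⟩
      U * a + P * (1# + P) + x * (1# + q * P)
        ≈⟨ solve 4 (λ w p x q → w :+ p :* (con 1 :+ p) :+ x :* (con 1 :+ q :* p) :=
             x :+ (p :+ q :* (x :* p)) :+ p :* p :+ w) refl (U * a) P x q ⟩
      x + (P + q * (x * P)) + P * P + U * a ∎)

    F : ℕ → Carrier
    F zero    = U
    F (suc h) = P * F h

    -- The term h x Pʰ⁻¹ U, set to 0 at h = 0 where the exponent would be negative.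
    lower : ℕ → Carrier
    lower zero    = 0#
    lower (suc h) = ν (suc h) * (x * F h)

    -- Multiplication by P removes the negative exponent, so one formula covers all h; at h = 0 both
    -- sides vanish.
    P*lower : ∀ h → P * lower h ≈ ν h * (x * F h)
    P*lower zero    = trans (zeroʳ _) (sym (trans (*-congʳ ν-zero) (zeroˡ _)))
    P*lower (suc h) =
      solve 4 (λ p m x f → p :* (m :* (x :* f)) := m :* (x :* (p :* f))) refl P (ν (suc h)) x (F h)

    -- Induction on h with the product rule for P · Pʰ U: each group of terms of the Riccati
    -- equation raises the matching numerical coefficient by one.
    ∂F : ∀ h → ∂ (F h) ≈
      lower h + (F h + (ν h * F h + ν h * (q * (x * F h)))) + ν (suc h) * F (suc h)
    ∂F zero = begin
      ∂ U        ≈⟨ ∂U ⟩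
      U + P * U
        ≈⟨ solve 4 (λ x q p u → u :+ p :* u :=
             con 0 :+ (u :+ (con 0 :* u :+ con 0 :* (q :* (x :* u))))
             :+ (con 1 :+ con 0) :* (p :* u)) refl x q P U ⟩
      0# + (U + (0# * U + 0# * (q * (x * U)))) + (1# + 0#) * (P * U)
        ≈⟨ +-cong (+-congˡ (+-congˡ (+-cong (*-congʳ ν-zero) (*-congʳ ν-zero))))
             (*-congʳ (trans (ν-suc 0) (+-congˡ ν-zero))) ⟨
      0# + (U + (ν 0 * U + ν 0 * (q * (x * U)))) + ν 1 * (P * U) ∎
    ∂F (suc h) = begin
      ∂ (P * f)          ≈⟨ leibniz P f ⟩
      ∂ P * f + P * ∂ f  ≈⟨ +-cong (*-congʳ riccati) (*-congˡ (∂F h)) ⟩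
      (x + (P + q * (x * P)) + P * P) * f
        + P * (lower h + (f + (m * f + m * (q * (x * f)))) + m′ * (P * f))
        ≈⟨ solve 7 (λ x q p f m m′ e →
             (x :+ (p :+ q :* (x :* p)) :+ p :* p) :* f
               :+ p :* (e :+ (f :+ (m :* f :+ m :* (q :* (x :* f)))) :+ m′ :* (p :* f))
             := (x :* f :+ p :* e)
               :+ (p :* f :+ ((con 1 :+ m) :* (p :* f) :+ (con 1 :+ m) :* (q :* (x :* (p :* f)))))
               :+ (con 1 :+ m′) :* (p :* (p :* f)))
             refl x q P f m m′ (lower h) ⟩
      (x * f + P * lower h)
        + (P * f + ((1# + m) * (P * f) + (1# + m) * (q * (x * (P * f)))))
        + (1# + m′) * (P * (P * f))
        ≈⟨ +-cong (+-cong x*f+P*lower≈ (+-congˡ (+-cong (*-congʳ (ν-suc h)) (*-congʳ (ν-suc h)))))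
             (*-congʳ (ν-suc (suc h))) ⟨
      m′ * (x * f)
        + (P * f + (m′ * (P * f) + m′ * (q * (x * (P * f)))))
        + ν (suc (suc h)) * (P * (P * f)) ∎
      where
      f m m′ : Carrier
      f  = F h
      m  = ν h
      m′ = ν (suc h)

      x*f+P*lower≈ : m′ * (x * f) ≈ x * f + P * lower h
      x*f+P*lower≈ = begin
        m′ * (x * f)                ≈⟨ *-congʳ (ν-suc h) ⟩
        (1# + m) * (x * f)          ≈⟨ distribʳ _ _ _ ⟩
        1# * (x * f) + m * (x * f)  ≈⟨ +-cong (*-identityˡ _) (sym (P*lower h)) ⟩
        x * f + P * lower h         ∎

-- Descents and double descents after inserting a first letter.

-- Comparing only the Boolean outcomes makes the facts about `<ᵇ` sufficient, and the two indexings
-- match positions shifted by `suc` with unshifted ones.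
length-filter-tabulate : ∀ {a b p r} {A : Set a} {B : Set b} {P : Pred A p} {R : Pred B r}
  (P? : Decidable P) (R? : Decidable R) {n} (f : Fin n → A) (g : Fin n → B) →
  (∀ i → does (P? (f i)) ≡ does (R? (g i))) →
  length (filter P? (tabulate f)) ≡ length (filter R? (tabulate g))
length-filter-tabulate P? R? {zero}  f g P≡R = ≡.refl
length-filter-tabulate P? R? {suc n} f g P≡R with does (P? (f 0F)) | does (R? (g 0F)) | P≡R 0F
... | false | _ | ≡.refl = length-filter-tabulate P? R? (f ∘ suc) (g ∘ suc) (P≡R ∘ suc)
... | true  | _ | ≡.refl = ≡.cong suc (length-filter-tabulate P? R? (f ∘ suc) (g ∘ suc) (P≡R ∘ suc))

-- `punchIn j` fixes the values below j and moves the others above j.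
punchIn<ᵇpivot : ∀ {n} (j : Fin (suc n)) k → (toℕ (punchIn j k) <ᵇ toℕ j) ≡ (toℕ k <ᵇ toℕ j)
punchIn<ᵇpivot zero    k       = ≡.refl
punchIn<ᵇpivot (suc j) zero    = ≡.refl
punchIn<ᵇpivot (suc j) (suc k) = punchIn<ᵇpivot j k

-- `punchIn j` is strictly increasing, so a new first letter changes no comparison among the later
-- ones.
punchIn-<ᵇ : ∀ {n} (j : Fin (suc n)) k l →
             (toℕ (punchIn j k) <ᵇ toℕ (punchIn j l)) ≡ (toℕ k <ᵇ toℕ l)
punchIn-<ᵇ zero    k       l       = ≡.refl
punchIn-<ᵇ (suc j) zero    zero    = ≡.refl
punchIn-<ᵇ (suc j) zero    (suc l) = ≡.refl
punchIn-<ᵇ (suc j) (suc k) zero    = ≡.refl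
punchIn-<ᵇ (suc j) (suc k) (suc l) = punchIn-<ᵇ j k l

startsWithDescent : ∀ {n} → Permutation′ n → Bool
startsWithDescent {suc (suc n)} σ = toℕ (σ ⟨$⟩ʳ 1F) <ᵇ toℕ (σ ⟨$⟩ʳ 0F)
startsWithDescent               σ = false

insert-startsWithDescent : ∀ {n} j k (π : Permutation′ n) →
  startsWithDescent (insert 0F j (insert 0F k π)) ≡ (toℕ k <ᵇ toℕ j)
insert-startsWithDescent j k π = punchIn<ᵇpivot j k

-- Only the position at the front is new; all later comparisons are those of `π`.
des-insert : ∀ {n} j (π : Permutation′ n) →
             des (insert 0F j π) ≡ (if startsWithDescent (insert 0F j π) then 1 else 0) ℕ.+ des π
des-insert {zero}  j π = ≡.refl
des-insert {suc n} j π with toℕ (punchIn j (π ⟨$⟩ʳ 0F)) <ᵇ toℕ j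
... | true  = ≡.cong suc (length-filter-tabulate _ _ suc id
  λ i → punchIn-<ᵇ j (π ⟨$⟩ʳ suc i) (π ⟨$⟩ʳ inject₁ i))
... | false = length-filter-tabulate _ _ suc id
  λ i → punchIn-<ᵇ j (π ⟨$⟩ʳ suc i) (π ⟨$⟩ʳ inject₁ i)

punchIn-double-descent :
  ∀ {n} (j : Fin (suc (suc (suc n)))) (π : Permutation′ (suc (suc n))) (i : Fin n) →
  (toℕ (punchIn j (π ⟨$⟩ʳ suc (inject₁ i))) <ᵇ toℕ (punchIn j (π ⟨$⟩ʳ inject₁ (inject₁ i))))
    ∧ (toℕ (punchIn j (π ⟨$⟩ʳ suc (suc i))) <ᵇ toℕ (punchIn j (π ⟨$⟩ʳ suc (inject₁ i))))
  ≡ (toℕ (π ⟨$⟩ʳ suc (inject₁ i)) <ᵇ toℕ (π ⟨$⟩ʳ inject₁ (inject₁ i)))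
    ∧ (toℕ (π ⟨$⟩ʳ suc (suc i)) <ᵇ toℕ (π ⟨$⟩ʳ suc (inject₁ i)))
punchIn-double-descent j π i = ≡.cong₂ _∧_ (punchIn-<ᵇ j _ _) (punchIn-<ᵇ j _ _)

occ-insert : ∀ {n} j (π : Permutation′ n) → occ₃₂₁ (insert 0F j π) ≡
  (if startsWithDescent (insert 0F j π) ∧ startsWithDescent π then 1 else 0) ℕ.+ occ₃₂₁ π
occ-insert {zero}        j π = ≡.refl
occ-insert {suc zero}    j π with toℕ (punchIn j (π ⟨$⟩ʳ 0F)) <ᵇ toℕ j
... | true  = ≡.refl
... | false = ≡.refl
-- The second comparison occurs in `insert 0F j π` on the left and in `π` on the right; the third
-- abstracted term identifies the two.
occ-insert {suc (suc n)} j π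
  with toℕ (punchIn j (π ⟨$⟩ʳ 0F)) <ᵇ toℕ j
     | toℕ (punchIn j (π ⟨$⟩ʳ 1F)) <ᵇ toℕ (punchIn j (π ⟨$⟩ʳ 0F))
     | punchIn-<ᵇ j (π ⟨$⟩ʳ 1F) (π ⟨$⟩ʳ 0F)
... | true  | true  | eq rewrite ≡.sym eq =
  ≡.cong suc (length-filter-tabulate _ _ suc id (punchIn-double-descent j π))
... | true  | false | eq rewrite ≡.sym eq =
  length-filter-tabulate _ _ suc id (punchIn-double-descent j π)
... | false | _     | eq = length-filter-tabulate _ _ suc id (punchIn-double-descent j π)

-- Weighted sums over permutations with a prescribed first value.

module Weights {κ μ} (R : CommutativeRing κ μ) where

  open CommutativeRing R hiding (zero)
  open ContinuedFraction R using (sumOver; _^_)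
  open import Algebra.Properties.Semiring.Sum semiring
    using (sum-syntax; sum⁺-syntax; sum-cong-≋)
  open import Algebra.Solver.Ring.NaturalCoefficients.Default commutativeSemiring
    using (solve; _:=_; _:+_; _:*_)
  open import Relation.Binary.Reasoning.Setoid setoid

  sumOver-cong : ∀ {a} {A : Set a} (xs : List A) {f g : A → Carrier} →
                 (∀ y → f y ≈ g y) → sumOver xs f ≈ sumOver xs g
  sumOver-cong []       f≈g = refl
  sumOver-cong (y ∷ xs) f≈g = +-cong (f≈g y) (sumOver-cong xs f≈g)

  sumOver-* : ∀ {a} {A : Set a} c (xs : List A) (f : A → Carrier) →
              sumOver xs (λ y → c * f y) ≈ c * sumOver xs f
  sumOver-* c []       f = sym (zeroʳ c)
  sumOver-* c (y ∷ xs) f = trans (+-congˡ (sumOver-* c xs f)) (sym (distribˡ c _ _))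

  sumOver-if : ∀ {a} {A : Set a} b c (xs : List A) (f g : A → Carrier) →
    sumOver xs (λ y → if b then c * f y else g y)
      ≈ (if b then c * sumOver xs f else sumOver xs g)
  sumOver-if true  c xs f g = sumOver-* c xs f
  sumOver-if false c xs f g = refl

  sumOver-map-++ : ∀ {a b} {A : Set a} {B : Set b} (h : A → B) xs ys (f : B → Carrier) →
                   sumOver (List.map h xs List.++ ys) f ≈ sumOver xs (f ∘ h) + sumOver ys f
  sumOver-map-++ h []       ys f = sym (+-identityˡ _)
  sumOver-map-++ h (x ∷ xs) ys f = trans (+-congˡ (sumOver-map-++ h xs ys f)) (sym (+-assoc _ _ _))

  sumOver-cartesianProductWith :
    ∀ {a b c} {A : Set a} {B : Set b} {C : Set c} (h : A → B → C)
      {n} (k : Fin n → A) ys (f : C → Carrier) →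
    sumOver (cartesianProductWith h (tabulate k) ys) f
      ≈ ∑[ i < n ] sumOver ys (f ∘ h (k i))
  sumOver-cartesianProductWith h {zero}  k ys f = refl
  sumOver-cartesianProductWith h {suc n} k ys f = trans (sumOver-map-++ (h (k 0F)) ys _ f)
    (+-congˡ (sumOver-cartesianProductWith h (k ∘ suc) ys f))

  sumOver-permutations-suc : ∀ n (f : Permutation′ (suc n) → Carrier) →
    sumOver (permutations (suc n)) f ≈ ∑[ k ≤ n ] sumOver (permutations n) (f ∘ insert 0F k)
  sumOver-permutations-suc n f =
    sumOver-cartesianProductWith (insert 0F) id (permutations n) f

  -- The weights of the permutations of length n + 1 with first value `j`, each arising from one
  -- insertion.
  sumFrom : (∀ {n} → Permutation′ n → Carrier) → ∀ n → Fin (suc n) → Carrier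
  sumFrom wt n j = sumOver (permutations n) (wt ∘ insert 0F j)

  -- Raising the threshold by one switches the single summand k = j from `g` to `f`.
  threshold-step : ∀ {n} (f g : Fin n → Carrier) (j : Fin n) →
    ∑[ k < n ] (if toℕ k <ᵇ suc (toℕ j) then f k else g k) + g j
      ≈ ∑[ k < n ] (if toℕ k <ᵇ toℕ j then f k else g k) + f j
  threshold-step f g zero    =
    solve 3 (λ f g s → f :+ s :+ g := g :+ s :+ f) refl (f 0F) (g 0F) _
  threshold-step f g (suc j) = begin
    f 0F + _ + g (suc j)   ≈⟨ +-assoc _ _ _ ⟩
    f 0F + (_ + g (suc j)) ≈⟨ +-congˡ (threshold-step (f ∘ suc) (g ∘ suc) j) ⟩
    f 0F + (_ + f (suc j)) ≈⟨ +-assoc _ _ _ ⟨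
    f 0F + _ + f (suc j)   ∎

  module _ (x q : Carrier) where

    weight : ∀ {n} → Permutation′ n → Carrier
    weight σ = x ^ des σ * q ^ occ₃₂₁ σ

    -- The weight of σ when it is preceded by a letter larger than σ(1).
    weight↓ : ∀ {n} → Permutation′ n → Carrier
    weight↓ σ = if startsWithDescent σ then q * weight σ else weight σ

    -- A descent at the front contributes x, and also q if `π` itself starts with a descent;
    -- `weight↓` absorbs that q.
    weight-insert : ∀ {n} j (π : Permutation′ n) → weight (insert 0F j π) ≈
      (if startsWithDescent (insert 0F j π) then x * weight↓ π else weight π)
    weight-insert j π rewrite des-insert j π | occ-insert j π
      with startsWithDescent (insert 0F j π) | startsWithDescent π
    ... | false | _     = refl
    ... | true  | false = *-assoc _ _ _
    ... | true  | true  =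
      solve 4 (λ x X q Q → x :* X :* (q :* Q) := x :* (q :* (X :* Q)))
        refl x (x ^ des π) q (q ^ occ₃₂₁ π)

    weight↓-insert : ∀ {n} j (π : Permutation′ n) → weight↓ (insert 0F j π) ≈
      (if startsWithDescent (insert 0F j π) then q * x * weight↓ π else weight π)
    weight↓-insert j π with startsWithDescent (insert 0F j π) | weight-insert j π
    ... | false | eq = eq
    ... | true  | eq = trans (*-congˡ eq) (sym (*-assoc _ _ _))

    total : ℕ → Carrier
    total n = sumOver (permutations n) weight

    total-suc : ∀ n → total (suc n) ≈ ∑[ j ≤ n ] sumFrom weight n j
    total-suc n = sumOver-permutations-suc n weight

    -- Treats `weight` with c = x and `weight↓` with c = q x together.
    module _ {c : Carrier} (wt : ∀ {n} → Permutation′ n → Carrier)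
             (wt-insert : ∀ {n} j (π : Permutation′ n) → wt (insert 0F j π) ≈
               (if startsWithDescent (insert 0F j π) then c * weight↓ π else weight π))
             where

      -- Classifies by the rank k of the second letter among the letters after the first: the front
      -- is a descent exactly when k < j.
      sumFrom-suc : ∀ n j → sumFrom wt (suc n) j ≈
        ∑[ k ≤ n ] (if toℕ k <ᵇ toℕ j then c * sumFrom weight↓ n k else sumFrom weight n k)
      sumFrom-suc n j =
        trans (sumOver-permutations-suc n (wt ∘ insert 0F j)) (sum-cong-≋ {suc n} λ k →
        trans (sumOver-cong (permutations n) λ π → wt-insert² k π)
              (sumOver-if (toℕ k <ᵇ toℕ j) c (permutations n) _ _))
        where
        wt-insert² : ∀ k (π : Permutation′ n) → wt (insert 0F j (insert 0F k π)) ≈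
          (if toℕ k <ᵇ toℕ j then c * weight↓ (insert 0F k π) else weight (insert 0F k π))
        wt-insert² k π = ≡.subst
          (λ b → wt (insert 0F j (insert 0F k π)) ≈
                 (if b then c * weight↓ (insert 0F k π) else weight (insert 0F k π)))
          (insert-startsWithDescent j k π) (wt-insert j (insert 0F k π))

      -- The smallest letter in front creates no descent, so deleting it preserves the weight.
      sumFrom-first : ∀ n → sumFrom wt n 0F ≈ total n
      sumFrom-first zero    = +-congʳ (wt-insert 0F _)
      sumFrom-first (suc n) = trans (sumFrom-suc n 0F) (sym (total-suc n))

      -- Passing from first value j to j + 1 changes only the summand with second rank j, from an
      -- ascent to a descent. This difference equation becomes the differential equation for the
      -- closed form.
      sumFrom-step : ∀ n j → sumFrom wt (suc n) (suc j) + sumFrom weight n j ≈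
                             sumFrom wt (suc n) (inject₁ j) + c * sumFrom weight↓ n j
      sumFrom-step n j = begin
        sumFrom wt (suc n) (suc j) + sumFrom weight n j
          ≈⟨ +-congʳ (sumFrom-suc n (suc j)) ⟩
        S (suc (toℕ j)) + sumFrom weight n j
          ≈⟨ threshold-step (λ k → c * sumFrom weight↓ n k) (sumFrom weight n) j ⟩
        S (toℕ j) + c * sumFrom weight↓ n j
          ≡⟨ ≡.cong (λ i → S i + c * sumFrom weight↓ n j) (toℕ-inject₁ j) ⟨
        S (toℕ (inject₁ j)) + c * sumFrom weight↓ n j
          ≈⟨ +-congʳ (sumFrom-suc n (inject₁ j)) ⟨
        sumFrom wt (suc n) (inject₁ j) + c * sumFrom weight↓ n j ∎
        where
        S : ℕ → Carrier
        S i = ∑[ k ≤ n ] (if toℕ k <ᵇ i then c * sumFrom weight↓ n k else sumFrom weight n k)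

-- Closed forms for the sums with prescribed first value.

module _ {κ μ} (R : CommutativeRing κ μ) where

  open CommutativeRing R hiding (zero)
  open ContinuedFraction R
  open JFraction R using (jFraction-unique)
  open Weights R
  open Hurwitz commutativeSemiring
    using (Sequence; _⊞_; _⋆_; ∂; const; const-⋆; ⋆-cong; ⋆-distribˡ)
    renaming (commutativeSemiring to hurwitz)
  open import Algebra.Properties.Group +-group using (∙-cancelʳ)
  open import Algebra.Properties.Semiring.Sum semiring
    using (sum⁺-syntax; sum-cong-≋; sum-init-last; sum-replicate)
  open import Algebra.Properties.Semiring.Mult semiring using (_×_)
  open import Algebra.Solver.Ring.NaturalCoefficients.Default commutativeSemiring
    using (solve; _:=_; _:+_; _:*_; con)
  open import Relation.Binary.Reasoning.Setoid setoid
  private module H = CommutativeSemiring hurwitz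

  -- The k-th derivative of an exponential generating function.
  shift : ℕ → Sequence → Sequence
  shift k F n = F (k ℕ.+ n)

  ∂-shift : ∀ k F → ∂ (shift k F) ≋ shift (suc k) F
  ∂-shift k F n = reflexive (≡.cong F (ℕ.+-suc k n))

  suc-∸-toℕ : ∀ {n} (j : Fin (suc n)) → suc n ∸ toℕ j ≡ suc (n ∸ toℕ j)
  suc-∸-toℕ j = ℕ.+-∸-assoc 1 (toℕ≤pred[n] j)

  -- The last summand is (F ⋆ ∂ G) at degree n, and the others form the same sum for `∂ F`; the
  -- Leibniz rule recombines the two. The term left at the end has the factor `G 0`, which is 0.
  ∑-shift-⋆-∂ : ∀ F G → G 0 ≈ 0# → ∀ n →
    ∑[ j ≤ n ] ((shift (n ∸ toℕ j) F ⋆ ∂ G) (toℕ j)) ≈ (F ⋆ G) (suc n)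
  ∑-shift-⋆-∂ F G G₀≈0 zero    = begin
    F 0 * G 1 + 0#         ≈⟨ +-comm _ _ ⟩
    0# + F 0 * G 1         ≈⟨ +-congʳ (trans (*-congˡ G₀≈0) (zeroʳ _)) ⟨
    F 1 * G 0 + F 0 * G 1  ∎
  ∑-shift-⋆-∂ F G G₀≈0 (suc n) = begin
    ∑[ j ≤ suc n ] t j                             ≈⟨ sum-init-last {suc n} t ⟩
    ∑[ j ≤ n ] t (inject₁ j) + t (fromℕ (suc n))   ≈⟨ +-cong (sum-cong-≋ {suc n} initial) final ⟩
    ∑[ j ≤ n ] ((shift (n ∸ toℕ j) (∂ F) ⋆ ∂ G) (toℕ j)) + (F ⋆ ∂ G) (suc n)
      ≈⟨ +-congʳ (∑-shift-⋆-∂ (∂ F) G G₀≈0 n) ⟩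
    (∂ F ⋆ G) (suc n) + (F ⋆ ∂ G) (suc n)          ∎
    where
    t : Fin (suc (suc n)) → Carrier
    t j = (shift (suc n ∸ toℕ j) F ⋆ ∂ G) (toℕ j)

    initial : ∀ j → t (inject₁ j) ≈ (shift (n ∸ toℕ j) (∂ F) ⋆ ∂ G) (toℕ j)
    initial j rewrite toℕ-inject₁ j | suc-∸-toℕ j = refl

    final : t (fromℕ (suc n)) ≈ (F ⋆ ∂ G) (suc n)
    final rewrite toℕ-fromℕ n | ℕ.n∸n≡0 n = refl

  1^n≈1 : ∀ n → 1# ^ n ≈ 1#
  1^n≈1 zero    = refl
  1^n≈1 (suc n) = trans (*-identityˡ _) (1^n≈1 n)

  [n]⟨1,1⟩≈n×1 : ∀ n → [ n ]⟨ 1# , 1# ⟩ ≈ n × 1#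
  [n]⟨1,1⟩≈n×1 n = trans
    (sum-cong-≋ {n} λ i → trans (*-cong (1^n≈1 (n ∸ 1 ∸ toℕ i)) (1^n≈1 (toℕ i))) (*-identityˡ 1#))
    (sum-replicate n)

  module _ (x q : Carrier) where

    A a b : Sequence
    A zero    = 0#
    A (suc n) = a n
    a zero    = 1#
    a (suc n) = x * b n - a n
    b zero    = 1#
    b (suc n) = q * x * b n - a n

    x-y+y≈x : ∀ y z → y - z + z ≈ y
    x-y+y≈x y z = trans (+-assoc y (- z) z) (trans (+-congˡ (-‿inverseˡ z)) (+-identityʳ y))

    ∂a : ∂ a ⊞ a ≋ const x ⋆ b
    ∂a n = trans (x-y+y≈x _ _) (sym (const-⋆ x b n))

    ∂b : ∂ b ⊞ a ≋ const (q * x) ⋆ b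
    ∂b n = trans (x-y+y≈x _ _) (sym (const-⋆ (q * x) b n))

    -- b − q a = (1 − q)(1 − A), by integrating b′ − q a′ = (q − 1) a, with the
    -- terms moved so that no subtraction occurs.
    b-integral : b ⊞ (const q ⊞ A) ≋ const q ⋆ a ⊞ const 1# ⊞ const q ⋆ A
    b-integral n = trans (pointwise n)
      (sym (+-cong (+-congʳ (const-⋆ q a n)) (const-⋆ q A n)))
      where
      pointwise : ∀ n → b n + (const q n + A n) ≈ q * a n + const 1# n + q * A n
      pointwise zero    =
        solve 1 (λ q → con 1 :+ (q :+ con 0) := q :* con 1 :+ con 1 :+ q :* con 0) refl q
      pointwise (suc n) = begin
        b (suc n) + (0# + a n)            ≈⟨ +-congˡ (+-identityˡ _) ⟩
        b (suc n) + a n                   ≈⟨ x-y+y≈x _ _ ⟩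
        q * x * b n                       ≈⟨ *-assoc _ _ _ ⟩
        q * (x * b n)                     ≈⟨ *-congˡ (x-y+y≈x _ _) ⟨
        q * (a (suc n) + a n)
          ≈⟨ solve 3 (λ q a a′ → q :* (a′ :+ a) := q :* a′ :+ con 0 :+ q :* a)
               refl q (a n) (a (suc n)) ⟩
        q * a (suc n) + 0# + q * a n ∎

    -- The sums are the coefficients of sʲ tⁿ⁻ʲ / (j! (n − j)!) in U(s + t) d(s).
    ClosedForm : (∀ {n} → Permutation′ n → Carrier) → Sequence → ℕ → Set μ
    ClosedForm wt d n = ∀ j → sumFrom wt n j ≈ (shift (n ∸ toℕ j) (total x q) ⋆ d) (toℕ j)

    -- Covers `weight` with d = a and `weight↓` with d = b; the equation for `∂ d` is the
    -- differential form of `sumFrom-step`.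
    module _ {c : Carrier} (wt : ∀ {n} → Permutation′ n → Carrier)
             (wt-insert : ∀ {n} j (π : Permutation′ n) → wt (insert 0F j π) ≈
               (if startsWithDescent (insert 0F j π) then c * weight↓ x q π else weight x q π))
             (d : Sequence) (d₀≈1 : d 0 ≈ 1#) (∂d : ∂ d ⊞ a ≋ const c ⋆ b)
             where

      closedForm-first : ∀ n → sumFrom wt n 0F ≈ (shift n (total x q) ⋆ d) 0
      closedForm-first n = begin
        sumFrom wt n 0F            ≈⟨ sumFrom-first x q wt wt-insert n ⟩
        total x q n                ≡⟨ ≡.cong (total x q) (ℕ.+-identityʳ n) ⟨
        total x q (n ℕ.+ 0)        ≈⟨ trans (*-congˡ d₀≈1) (*-identityʳ _) ⟨
        total x q (n ℕ.+ 0) * d 0  ∎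

      -- Induction on the first value: the Leibniz rule for `S ⋆ d` together with the equation for
      -- `∂ d` reproduces `sumFrom-step`.
      closedForm-suc : ∀ n → ClosedForm (weight x q) a n → ClosedForm (weight↓ x q) b n →
                       ClosedForm wt d (suc n)
      closedForm-suc n u≈ v≈ = <-weakInduction _ (closedForm-first (suc n)) step
        where
        step : ∀ j →
          sumFrom wt (suc n) (inject₁ j)
            ≈ (shift (suc n ∸ toℕ (inject₁ j)) (total x q) ⋆ d) (toℕ (inject₁ j)) →
          sumFrom wt (suc n) (suc j)
            ≈ (shift (n ∸ toℕ j) (total x q) ⋆ d) (suc (toℕ j))
        -- After rewriting, the preceding first value carries the shift k + 1, that is, the
        -- derivative of `S`.
        step j ih rewrite toℕ-inject₁ j | suc-∸-toℕ j =
          ∙-cancelʳ (sumFrom (weight x q) n j) _ _ (begin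
          sumFrom wt (suc n) (suc j) + sumFrom (weight x q) n j
            ≈⟨ sumFrom-step x q wt wt-insert n j ⟩
          sumFrom wt (suc n) (inject₁ j) + c * sumFrom (weight↓ x q) n j
            ≈⟨ +-cong ih (*-congˡ (v≈ j)) ⟩
          (shift (suc k) T ⋆ d) i + c * (S ⋆ b) i
            ≈⟨ +-cong (⋆-cong {G = d} (∂-shift k T) (λ _ → refl) i) (const-⋆ c (S ⋆ b) i) ⟨
          (∂ S ⋆ d) i + (const c ⋆ (S ⋆ b)) i
            ≈⟨ +-congˡ (x∙yz≈y∙xz (const c) S b i) ⟩
          (∂ S ⋆ d) i + (S ⋆ (const c ⋆ b)) i
            ≈⟨ +-congˡ (⋆-cong {F = S} (λ _ → refl) ∂d i) ⟨
          (∂ S ⋆ d) i + (S ⋆ (∂ d ⊞ a)) i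
            ≈⟨ +-congˡ (⋆-distribˡ S (∂ d) a i) ⟩
          (∂ S ⋆ d) i + ((S ⋆ ∂ d) i + (S ⋆ a) i)
            ≈⟨ +-assoc _ _ _ ⟨
          (S ⋆ d) (suc i) + (S ⋆ a) i
            ≈⟨ +-congˡ (u≈ j) ⟨
          (S ⋆ d) (suc i) + sumFrom (weight x q) n j ∎)
          where
          open import Algebra.Properties.CommutativeSemigroup H.*-commutativeSemigroup
            using (x∙yz≈y∙xz)
          i k : ℕ
          i = toℕ j
          k = n ∸ i
          T S : Sequence
          T = total x q
          S = shift k T

    -- The two closed forms are proved simultaneously, because the step for either weight uses both
    -- at the smaller length.
    sumFrom-closedForm : ∀ n → ClosedForm (weight x q) a n
    sumFrom-closedForm↓ : ∀ n → ClosedForm (weight↓ x q) b n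
    sumFrom-closedForm zero    0F = closedForm-first (weight x q) (weight-insert x q) a refl ∂a 0
    sumFrom-closedForm (suc n) = closedForm-suc (weight x q) (weight-insert x q) a refl ∂a n
      (sumFrom-closedForm n) (sumFrom-closedForm↓ n)
    sumFrom-closedForm↓ zero    0F = closedForm-first (weight↓ x q) (weight↓-insert x q) b refl ∂b 0
    sumFrom-closedForm↓ (suc n) = closedForm-suc (weight↓ x q) (weight↓-insert x q) b refl ∂b n
      (sumFrom-closedForm n) (sumFrom-closedForm↓ n)

    -- The equations satisfied by the generating function of all permutations.

    U P : Sequence
    U = total x q
    -- U a - 1 is formed by replacing the constant term 1 with 0, without a subtraction.
    P zero    = 0#
    P (suc n) = (U ⋆ a) (suc n)

    U₀≈1 : U 0 ≈ 1#
    U₀≈1 = trans (+-identityʳ _) (*-identityˡ _)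

    -- Sums the closed form over all first values; `∂ A` is `a` by definition and `A` has constant
    -- term 0.
    U-suc : ∀ n → U (suc n) ≈ (U ⋆ A) (suc n)
    U-suc n = begin
      U (suc n)                                       ≈⟨ total-suc x q n ⟩
      ∑[ j ≤ n ] sumFrom (weight x q) n j             ≈⟨ sum-cong-≋ {suc n} (sumFrom-closedForm n) ⟩
      ∑[ j ≤ n ] ((shift (n ∸ toℕ j) U ⋆ a) (toℕ j))  ≈⟨ ∑-shift-⋆-∂ U A refl n ⟩
      (U ⋆ A) (suc n)                                 ∎

    U-fixed : U ≋ const 1# ⊞ U ⋆ A
    U-fixed zero    = trans U₀≈1 (sym (trans (+-congˡ (zeroʳ _)) (+-identityʳ _)))
    U-fixed (suc n) = trans (U-suc n) (sym (+-identityˡ _))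

    Ua≈1+P : U ⋆ a ≋ const 1# ⊞ P
    Ua≈1+P zero    = trans (*-identityʳ _) (trans U₀≈1 (sym (+-identityʳ _)))
    Ua≈1+P (suc n) = sym (+-identityˡ _)

    ν : ℕ → Sequence
    ν h = const (h × 1#)

    ν-zero : ∀ n → ν 0 n ≈ 0#
    ν-zero zero    = refl
    ν-zero (suc n) = refl

    ν-suc : ∀ h → ν (suc h) ≋ const 1# ⊞ ν h
    ν-suc h zero    = refl
    ν-suc h (suc n) = sym (+-identityˡ 0#)

    ⊞-cancelʳ : ∀ F G H → (G ⊞ F) ≋ (H ⊞ F) → G ≋ H
    ⊞-cancelʳ F G H G⊞F≋H⊞F n = ∙-cancelʳ (F n) (G n) (H n) (G⊞F≋H⊞F n)

    ∂-leibniz : ∀ F G → ∂ (F ⋆ G) ≋ ∂ F ⋆ G ⊞ F ⋆ ∂ G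
    ∂-leibniz F G n = refl

    ∂U-fixed : ∂ U ≋ ∂ U ⋆ A ⊞ U ⋆ a
    -- The coefficient of `U ⋆ A` at `suc n` unfolds by the Leibniz rule built into `⋆`.
    ∂U-fixed = U-suc

    ∂P : ∂ P ≋ ∂ (U ⋆ a)
    ∂P n = refl

    -- Matching Pʰ U with the weights of the continued fraction.

    private
      module Ric = Riccati.Solution hurwitz ⊞-cancelʳ ∂ ∂-leibniz
        {x = const x} {q = const q} {A = A} {a = a} {b = b} {U = U} {P = P}
        ∂a b-integral U-fixed ∂U-fixed Ua≈1+P ∂P ν ν-zero ν-suc

    F : ℕ → Sequence
    F = Ric.F

    -- The specialised `α` at h is 1 + q x h + h, the coefficient 1 + h (1 + q x) of Pʰ U in its own
    -- derivative.
    level : ∀ h n → F h n + ((ν h ⋆ F h) n + (ν h ⋆ (const q ⋆ (const x ⋆ F h))) n)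
                      ≈ α (specialisation x q) h * F h n
    level h n = begin
      F h n + ((ν h ⋆ F h) n + (ν h ⋆ (const q ⋆ (const x ⋆ F h))) n)
        ≈⟨ +-congˡ (+-cong (const-⋆ _ (F h) n)
             (trans (const-⋆ _ (const q ⋆ (const x ⋆ F h)) n)
               (*-congˡ (trans (const-⋆ q (const x ⋆ F h) n) (*-congˡ (const-⋆ x (F h) n)))))) ⟩
      F h n + (h × 1# * F h n + h × 1# * (q * (x * F h n)))
        ≈⟨ solve 4 (λ f m q x → f :+ (m :* f :+ m :* (q :* (x :* f))) :=
             (con 1 :* con 1 :+ q :* x :* m :+ con 1 :* m) :* f) refl (F h n) (h × 1#) q x ⟩
      (1# * 1# + q * x * (h × 1#) + 1# * (h × 1#)) * F h n
        ≈⟨ *-congʳ (+-cong (+-cong (*-congˡ (1^n≈1 h)) (*-congˡ ([n]⟨1,1⟩≈n×1 h)))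
             (*-congˡ ([n]⟨1,1⟩≈n×1 h))) ⟨
      α (specialisation x q) h * F h n ∎

    -- The product x (h + 1)² is split according to the derivatives: `up h` is the coefficient of
    -- Pʰ⁺¹ U in (Pʰ U)′, and `down h` that of Pʰ U in (Pʰ⁺¹ U)′.
    up down : ℕ → Carrier
    up h   = suc h × 1#
    down h = suc h × 1# * x

    β≈up*down : ∀ h → β (specialisation x q) (suc h) ≈ up h * down h
    β≈up*down h = begin
      x * 1# * [ suc h ]⟨ 1# , 1# ⟩ * [ suc h ]⟨ 1# , 1# ⟩
        ≈⟨ *-cong (*-congˡ ([n]⟨1,1⟩≈n×1 (suc h))) ([n]⟨1,1⟩≈n×1 (suc h)) ⟩
      x * 1# * (suc h × 1#) * (suc h × 1#)
        ≈⟨ solve 2 (λ x m → x :* con 1 :* m :* m := m :* (m :* x)) refl x (suc h × 1#) ⟩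
      up h * down h ∎

    F-zero : ∀ n → F 0 (suc n) ≈ α (specialisation x q) 0 * F 0 n + up 0 * F 1 n
    F-zero n = begin
      F 0 (suc n)  ≈⟨ Ric.∂F 0 n ⟩
      _            ≈⟨ +-cong (trans (+-identityˡ _) (level 0 n)) (const-⋆ (up 0) (F 1) n) ⟩
      α (specialisation x q) 0 * F 0 n + up 0 * F 1 n ∎

    F-suc : ∀ h n → F (suc h) (suc n) ≈ down h * F h n
      + α (specialisation x q) (suc h) * F (suc h) n + up (suc h) * F (suc (suc h)) n
    F-suc h n = begin
      F (suc h) (suc n)  ≈⟨ Ric.∂F (suc h) n ⟩
      _                  ≈⟨ +-cong (+-cong lower≈ (level (suc h) n))
                              (const-⋆ (up (suc h)) (F (suc (suc h))) n) ⟩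
      down h * F h n + α (specialisation x q) (suc h) * F (suc h) n
        + up (suc h) * F (suc (suc h)) n ∎
      where
      lower≈ : (ν (suc h) ⋆ (const x ⋆ F h)) n ≈ down h * F h n
      lower≈ = trans (const-⋆ (up h) (const x ⋆ F h) n)
        (trans (*-congˡ (const-⋆ x (F h) n)) (sym (*-assoc _ _ _)))

    𝒞≋total : 𝒞 (specialisation x q) ≋ total x q
    𝒞≋total = jFraction-unique (α (specialisation x q)) (β (specialisation x q)) up down β≈up*down
      -- `P` has constant term 0, hence so has Pʰ⁺¹ U.
      F U₀≈1 (λ h → zeroˡ _) F-zero F-suc

corollary4 : ∀ {κ μ} (R : CommutativeRing κ μ) →
    let open CommutativeRing R
        open ContinuedFraction R
    in (x q : Carrier) →
       𝒞 (specialisation x q)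
         ≋ (λ n → sumOver (permutations n) (λ σ → x ^ des σ * q ^ occ₃₂₁ σ))
corollary4 R x q = 𝒞≋total R x q
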